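{- There is a function $g:\mathbb{N}\to\mathbb{R}$ with $g(n)=o(n)$ such that the following holds. Let $n\geq 4$, let $K$ be a complete graph of order $n$, and let $c:E(K)\to\{\pm 1\}$ be a balanced edge labeling of $K$. Then there is a Hamiltonian cycle $C$ of $K$ with $$m^+(C)\geq \left(2-\sqrt{2}\right)n-g(n).$$
   Context: An edge labeling $c:E(K)\to\{\pm1\}$ is balanced if the number of edges with label $+1$ (plus-edges) equals the number of edges with label $-1$. For a subgraph $H$ of $K$, $m^+(H)$ denotes the number of plus-edges of $H$. The $o(n)$ term (the function $g$) does not depend on $K$ or $c$. -}

module Defs where

open import Data.Bool using (Bool; true; false; if_then_else_; not; _∧_)
open import Data.Nat as ℕ using (ℕ; zero; suc; _<ᵇ_)
open import Data.Nat.Properties using (_<?_)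
open import Data.Fin using (Fin; zero; toℕ; fromℕ<)
open import Data.Fin.Permutation using (Permutation′; _⟨$⟩ʳ_)
open import Data.List using (List; map; allFin)
open import Data.Nat.ListAction using (sum)
open import Data.Integer using (+_)
open import Data.Rational using (ℚ; _/_; _+_; _-_; _*_; _≤_; 0ℚ)
open import Data.Sum using (_⊎_)
open import Relation.Binary.PropositionalEquality using (_≡_)
open import Relation.Nullary using (yes; no)

count : ∀ {n} → (Fin n → Bool) → ℕ
count {n} f = sum (map (λ i → if f i then 1 else 0) (allFin n))

-- vertices of K are Fin n; an edge {i,j} (i ≠ j) is labelled +1 iff c i j = true.
-- A labeling is a symmetric function (diagonal values are irrelevant).
Labeling : ℕ → Set
Labeling n = Fin n → Fin n → Bool

Symmetric : ∀ {n} → Labeling n → Set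
Symmetric {n} c = ∀ (i j : Fin n) → c i j ≡ c j i

plusEdgesK : ∀ {n} → Labeling n → ℕ
plusEdgesK {n} c = sum (map (λ i → count (λ j → (toℕ i <ᵇ toℕ j) ∧ c i j)) (allFin n))

minusEdgesK : ∀ {n} → Labeling n → ℕ
minusEdgesK {n} c = sum (map (λ i → count (λ j → (toℕ i <ᵇ toℕ j) ∧ not (c i j))) (allFin n))

Balanced : ∀ {n} → Labeling n → Set
Balanced c = plusEdgesK c ≡ minusEdgesK c

cyc : ∀ {n} → Fin n → Fin n
cyc {suc m} i with suc (toℕ i) <? suc m
... | yes p = fromℕ< p
... | no _ = zero

-- A Hamiltonian cycle of K_n (n ≥ 3) is given by a cyclic ordering σ of the
-- vertices: its edges are {σ k, σ (k+1 mod n)} for k : Fin n.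
HamCycle : ℕ → Set
HamCycle n = Permutation′ n

plusEdgesC : ∀ {n} → Labeling n → HamCycle n → ℕ
plusEdgesC c σ = count (λ k → c (σ ⟨$⟩ʳ k) (σ ⟨$⟩ʳ cyc k))

ℕtoℚ : ℕ → ℚ
ℕtoℚ n = (+ n) / 1

-- x ≥ (2 - √2) n, expressed without reals:
-- ⇔ 2n - x ≤ √2 n ⇔ (2n - x ≤ 0) or (2n - x)² ≤ 2 n²
GeTwoMinusSqrt2Times : ℚ → ℕ → Set
GeTwoMinusSqrt2Times x n =
  let t = (ℕtoℚ 2 * ℕtoℚ n) - x in
  (t ≤ 0ℚ) ⊎ (t * t ≤ ℕtoℚ 2 * (ℕtoℚ n * ℕtoℚ n))

{-# OPTIONS --safe #-}
module Submission where

-- Let H be the graph of plus-edges.  If u and v are non-adjacent and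
-- deg u + deg v ≥ k, a 2-opt exchange turns a Hamiltonian cycle with at least k
-- edges in H + uv into one with at least k edges in H, so (as in the
-- Bondy–Chvátal closure) H may be assumed to have deg u + deg v ≤ m := k - 1 for
-- all non-adjacent u ≠ v.  Then the w vertices of degree > m/2 form a clique.
-- If H is not complete, then either w ≤ m/2 + 1, or every other vertex misses
-- some clique vertex and so has degree ≤ m - (w - 1).  Counting degrees bounds
-- the number of edges by nm/2 - m²/8 + O(n) whenever m ≤ 4n/5, whereas
-- balancedness gives about n²/4 edges; hence (2n - m)² ≤ 2n² + O(n).  It follows
-- that some cycle has at least 2n - ⌊√2 n⌋ - 7 plus-edges.

open import Defs
open import Data.Bool using (Bool; true; false; T; if_then_else_; not; _∧_; _∨_)
import Data.Bool.Properties as Bool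
open import Data.Empty using (⊥-elim)
open import Data.Fin using (Fin; zero; suc; toℕ; cast; fromℕ<)
import Data.Fin.Permutation as Perm
import Data.Fin.Properties as Fin
open import Data.Integer as ℤ using (+[1+_]) renaming (+_ to pos)
import Data.Integer.Properties as ℤ
open import Data.Integer.Tactic.RingSolver using () renaming (solve-∀ to ℤ-solve-∀)
open import Data.List using (List; []; _∷_; _++_; _∷ʳ_; [_]; map; allFin; length; tabulate; lookup; reverse; initLast; _∷ʳ′_)
open import Data.List.Membership.Propositional using (_∈_)
open import Data.List.Membership.Propositional.Properties using (∈-allFin)
open import Data.List.Properties using (map-tabulate; length-tabulate; lookup-tabulate; tabulate-lookup; tabulate-cong; ++-assoc; ++-identityʳ; ∷ʳ-injective; ∷ʳ-++; ∷-injective; unfold-reverse)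
open import Data.List.Relation.Binary.Permutation.Homogeneous using (onIndices)
open import Data.List.Relation.Binary.Permutation.Propositional using (_↭_; prep; ↭-refl; ↭-sym; ↭-trans; ↭⇒↭ₛ)
import Data.List.Relation.Binary.Permutation.Propositional.Properties as ↭
import Data.List.Relation.Binary.Permutation.Setoid.Properties as ↭ₛ
open import Data.List.Relation.Unary.All using (All; []; _∷_)
import Data.List.Relation.Unary.All.Properties as All
open import Data.List.Relation.Unary.AllPairs using ([]; _∷_)
open import Data.List.Relation.Unary.Any using (here; there)
open import Data.List.Relation.Unary.Unique.Propositional using (Unique)
open import Data.List.Relation.Unary.Unique.Propositional.Properties using (allFin⁺)
open import Data.Nat using (ℕ; zero; suc; _+_; _*_; _∸_; _≤_; _<_; z≤n; s≤s; s<s⁻¹; _<ᵇ_)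
open import Data.Nat.ListAction using (sum)
open import Data.Nat.ListAction.Properties using (sum-↭)
open import Data.Nat.Properties
open import Data.Nat.Tactic.RingSolver using (solve-∀)
open import Data.Product using (Σ; ∃; ∃-syntax; _×_; _,_; proj₁; proj₂)
open import Data.Rational as ℚ using (ℚ; 0ℚ; ∣_∣; mkℚ)
import Data.Rational.Properties as ℚ
import Data.Rational.Unnormalised as ℚᵘ
import Data.Rational.Unnormalised.Properties as ℚᵘ
open import Data.Sum using (_⊎_; inj₁; inj₂)
open import Function using (_∘_; id)
open import Relation.Binary.Definitions using (tri<; tri≈; tri>)
open import Relation.Binary.PropositionalEquality hiding ([_])
open import Relation.Nullary using (¬_; yes; no; does; ¬?; _×-dec_)

private
  variable
    A B : Set
    n : ℕ

-- Indicators and finite sums.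

⟦_⟧ : Bool → ℕ
⟦ b ⟧ = if b then 1 else 0

⟦⟧≤1 : ∀ b → ⟦ b ⟧ ≤ 1
⟦⟧≤1 true  = ≤-refl
⟦⟧≤1 false = z≤n

∑ : List A → (A → ℕ) → ℕ
∑ xs f = sum (map f xs)

∑-cong : ∀ {f g : A → ℕ} xs → (∀ x → f x ≡ g x) → ∑ xs f ≡ ∑ xs g
∑-cong []       f≗g = refl
∑-cong (x ∷ xs) f≗g = cong₂ _+_ (f≗g x) (∑-cong xs f≗g)

∑-mono : ∀ {f g : A → ℕ} xs → (∀ x → f x ≤ g x) → ∑ xs f ≤ ∑ xs g
∑-mono []       f≤g = z≤n
∑-mono (x ∷ xs) f≤g = +-mono-≤ (f≤g x) (∑-mono xs f≤g)

∑-+ : ∀ {f g : A → ℕ} xs → ∑ xs (λ x → f x + g x) ≡ ∑ xs f + ∑ xs g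
∑-+ []       = refl
∑-+ {f = f} {g} (x ∷ xs) = begin
  f x + g x + ∑ xs (λ y → f y + g y) ≡⟨ cong (f x + g x +_) (∑-+ xs) ⟩
  f x + g x + (∑ xs f + ∑ xs g)      ≡⟨ lemma (f x) (g x) (∑ xs f) (∑ xs g) ⟩
  f x + ∑ xs f + (g x + ∑ xs g)      ∎
  where
    open ≡-Reasoning
    lemma : ∀ a b c d → a + b + (c + d) ≡ a + c + (b + d)
    lemma = solve-∀

∑-*ʳ : ∀ {f : A → ℕ} xs k → ∑ xs (λ x → f x * k) ≡ ∑ xs f * k
∑-*ʳ []       k = refl
∑-*ʳ {f = f} (x ∷ xs) k =
  trans (cong (f x * k +_) (∑-*ʳ xs k)) (sym (*-distribʳ-+ k (f x) (∑ xs f)))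

∑-const : ∀ (xs : List A) k → ∑ xs (λ _ → k) ≡ length xs * k
∑-const []       k = refl
∑-const (x ∷ xs) k = cong (k +_) (∑-const xs k)

∑-swap : ∀ (xs : List A) (ys : List B) (f : A → B → ℕ) →
  ∑ xs (λ x → ∑ ys (f x)) ≡ ∑ ys (λ y → ∑ xs (λ x → f x y))
∑-swap []       ys f = sym (trans (∑-const ys 0) (*-zeroʳ (length ys)))
∑-swap (x ∷ xs) ys f = trans (cong (∑ ys (f x) +_) (∑-swap xs ys f)) (sym (∑-+ ys))

∑-↭ : ∀ {xs ys : List A} (f : A → ℕ) → xs ↭ ys → ∑ xs f ≡ ∑ ys f
∑-↭ f p = sum-↭ (↭.map⁺ f p)

∑-allFin-const : ∀ n k → ∑ (allFin n) (λ _ → k) ≡ n * k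
∑-allFin-const n k =
  trans (∑-const (allFin n) k) (cong (_* k) (length-tabulate {n = n} id))

∑-allFin-suc : ∀ (f : Fin (suc n) → ℕ) →
  ∑ (allFin (suc n)) f ≡ f zero + ∑ (allFin n) (f ∘ suc)
∑-allFin-suc {n} f = cong (λ xs → f zero + sum xs)
  (trans (map-tabulate suc f) (sym (map-tabulate id (f ∘ suc))))

∑-indicator : ∀ (i : Fin n) → ∑ (allFin n) (λ j → ⟦ does (i Fin.≟ j) ⟧) ≡ 1
∑-indicator {suc n} zero = trans (∑-allFin-suc {n} (λ j → ⟦ does (zero Fin.≟ j) ⟧))
  (cong suc (trans (∑-allFin-const n 0) (*-zeroʳ n)))
∑-indicator {suc n} (suc i) = trans (∑-allFin-suc {n} (λ j → ⟦ does (suc i Fin.≟ j) ⟧)) (∑-indicator i)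

-- Degrees, the handshake identity and balanced labelings.

Irreflexive : Labeling n → Set
Irreflexive H = ∀ i → H i i ≡ false

deg : Labeling n → Fin n → ℕ
deg H i = count (H i)

-- For a symmetric irreflexive `H` this is twice the number of edges; all edge counts are kept in
-- this form, which avoids halving.
degSum : Labeling n → ℕ
degSum {n} H = ∑ (allFin n) (deg H)

∑∑ : (Fin n → Fin n → ℕ) → ℕ
∑∑ {n} f = ∑ (allFin n) (λ i → ∑ (allFin n) (f i))

∑∑-cong : ∀ {f g : Fin n → Fin n → ℕ} → (∀ i j → f i j ≡ g i j) → ∑∑ f ≡ ∑∑ g
∑∑-cong {n} h = ∑-cong (allFin n) (λ i → ∑-cong (allFin n) (h i))

∑∑-+ : ∀ (f g : Fin n → Fin n → ℕ) → ∑∑ (λ i j → f i j + g i j) ≡ ∑∑ f + ∑∑ g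
∑∑-+ {n} f g = trans (∑-cong (allFin n) (λ i → ∑-+ (allFin n))) (∑-+ (allFin n))

-- Diagonal values of a labeling are arbitrary; once they are cleared, row sums are degrees in the
-- graph of plus-edges.
offDiagonal : Labeling n → Labeling n
offDiagonal c i j = not (does (i Fin.≟ j)) ∧ c i j

offDiagonal-sym : ∀ {c : Labeling n} → Symmetric c → Symmetric (offDiagonal c)
offDiagonal-sym c-sym i j with i Fin.≟ j | j Fin.≟ i
... | yes _ | yes _ = refl
... | yes p | no ¬p = ⊥-elim (¬p (sym p))
... | no ¬p | yes p = ⊥-elim (¬p (sym p))
... | no _  | no _  = c-sym i j

offDiagonal-irrefl : ∀ (c : Labeling n) → Irreflexive (offDiagonal c)
offDiagonal-irrefl c i with i Fin.≟ i
... | yes _ = refl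
... | no ¬p = ⊥-elim (¬p refl)

<ᵇ-true : ∀ {a b} → a < b → (a <ᵇ b) ≡ true
<ᵇ-true {a} {b} a<b with a <ᵇ b | <⇒<ᵇ a<b
... | true | _ = refl

<ᵇ-false : ∀ {a b} → b ≤ a → (a <ᵇ b) ≡ false
<ᵇ-false {a} {b} b≤a with a <ᵇ b in eq
... | false = refl
... | true  = ⊥-elim (<⇒≱ (<ᵇ⇒< a b (subst T (sym eq) _)) b≤a)

offDiagonal-split : ∀ {c : Labeling n} → Symmetric c → ∀ i j →
  ⟦ offDiagonal c i j ⟧ ≡ ⟦ (toℕ i <ᵇ toℕ j) ∧ c i j ⟧ + ⟦ (toℕ j <ᵇ toℕ i) ∧ c j i ⟧
offDiagonal-split {c = c} c-sym i j with i Fin.≟ j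
... | yes refl rewrite <ᵇ-false (≤-refl {toℕ i}) = refl
... | no i≢j with <-cmp (toℕ i) (toℕ j)
...   | tri< i<j _ _ rewrite <ᵇ-true i<j | <ᵇ-false (<⇒≤ i<j) = sym (+-identityʳ _)
...   | tri≈ _ i≡j _ = ⊥-elim (i≢j (Fin.toℕ-injective i≡j))
...   | tri> _ _ j<i rewrite <ᵇ-true j<i | <ᵇ-false (<⇒≤ j<i) = cong ⟦_⟧ (c-sym i j)

-- `plusEdgesK` sums the entries above the diagonal; by symmetry those below it form the transposed
-- sum.
handshake : ∀ {c : Labeling n} → Symmetric c →
  degSum (offDiagonal c) ≡ plusEdgesK c + plusEdgesK c
handshake {n} {c} c-sym = begin
  degSum (offDiagonal c)                              ≡⟨ ∑∑-cong (offDiagonal-split c-sym) ⟩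
  ∑∑ (λ i j → upper i j + upper j i)                  ≡⟨ ∑∑-+ upper (λ i j → upper j i) ⟩
  plusEdgesK c + ∑∑ (λ i j → upper j i)
    ≡⟨ cong (plusEdgesK c +_) (∑-swap (allFin n) (allFin n) (λ i j → upper j i)) ⟩
  plusEdgesK c + plusEdgesK c                         ∎
  where
    open ≡-Reasoning
    upper : Fin n → Fin n → ℕ
    upper i j = ⟦ (toℕ i <ᵇ toℕ j) ∧ c i j ⟧

-- By the handshake identity the plus-graph and the minus-graph have equal degree sums, and their
-- adjacency matrices add up with the identity matrix to the all-ones matrix.
balanced-degSum : ∀ {c : Labeling n} → Symmetric c → Balanced c →
  degSum (offDiagonal c) + degSum (offDiagonal c) + n ≡ n * n
balanced-degSum {n} {c} c-sym bal = begin
  degSum (offDiagonal c) + degSum (offDiagonal c) + n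
    ≡⟨ cong (λ d → degSum (offDiagonal c) + d + n) complement ⟩
  degSum (offDiagonal c) + degSum (offDiagonal c̄) + n
    ≡⟨ cong (degSum (offDiagonal c) + degSum (offDiagonal c̄) +_) (sym diagonal) ⟩
  degSum (offDiagonal c) + degSum (offDiagonal c̄) + ∑∑ δ
    ≡⟨ cong (_+ ∑∑ δ) (sym (∑∑-+ (λ i j → ⟦ offDiagonal c i j ⟧) (λ i j → ⟦ offDiagonal c̄ i j ⟧))) ⟩
  ∑∑ (λ i j → ⟦ offDiagonal c i j ⟧ + ⟦ offDiagonal c̄ i j ⟧) + ∑∑ δ
    ≡⟨ sym (∑∑-+ (λ i j → ⟦ offDiagonal c i j ⟧ + ⟦ offDiagonal c̄ i j ⟧) δ) ⟩
  ∑∑ (λ i j → ⟦ offDiagonal c i j ⟧ + ⟦ offDiagonal c̄ i j ⟧ + δ i j)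
    ≡⟨ ∑∑-cong one ⟩
  ∑∑ {n} (λ _ _ → 1)
    ≡⟨ ∑-cong (allFin n) (λ _ → trans (∑-allFin-const n 1) (*-identityʳ n)) ⟩
  ∑ (allFin n) (λ _ → n)
    ≡⟨ ∑-allFin-const n n ⟩
  n * n ∎
  where
    open ≡-Reasoning
    c̄ : Labeling n
    c̄ i j = not (c i j)
    δ : Fin n → Fin n → ℕ
    δ i j = ⟦ does (i Fin.≟ j) ⟧
    complement : degSum (offDiagonal c) ≡ degSum (offDiagonal c̄)
    complement = trans (handshake c-sym)
      (trans (cong₂ _+_ bal bal) (sym (handshake (λ i j → cong not (c-sym i j)))))
    diagonal : ∑∑ δ ≡ n
    diagonal = trans (∑-cong (allFin n) ∑-indicator)
      (trans (∑-allFin-const n 1) (*-identityʳ n))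
    one : ∀ i j → ⟦ offDiagonal c i j ⟧ + ⟦ offDiagonal c̄ i j ⟧ + δ i j ≡ 1
    one i j with does (i Fin.≟ j) | c i j
    ... | true  | _     = refl
    ... | false | true  = refl
    ... | false | false = refl

-- Hamiltonian cycles as lists and the 2-opt exchange

walk : Labeling n → Fin n → List (Fin n) → ℕ
walk H x []       = 0
walk H x (y ∷ ys) = ⟦ H x y ⟧ + walk H y ys

-- A cyclic order is kept as a list, so that cutting, rotating and reversing it become list
-- operations; the last step returns to the head.
cycleValue : Labeling n → List (Fin n) → ℕ
cycleValue H []       = 0
cycleValue H (x ∷ xs) = walk H x (xs ∷ʳ x)

walk-++ : ∀ (H : Labeling n) x xs y ys →
  walk H x (xs ++ y ∷ ys) ≡ walk H x (xs ∷ʳ y) + walk H y ys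
walk-++ H x []       y ys = cong (_+ walk H y ys) (sym (+-identityʳ _))
walk-++ H x (z ∷ xs) y ys =
  trans (cong (⟦ H x z ⟧ +_) (walk-++ H z xs y ys)) (sym (+-assoc ⟦ H x z ⟧ _ _))

walk-∷ʳ∷ʳ : ∀ (H : Labeling n) x xs y z →
  walk H x (xs ∷ʳ y ∷ʳ z) ≡ walk H x (xs ∷ʳ y) + ⟦ H y z ⟧
walk-∷ʳ∷ʳ H x xs y z = trans (cong (walk H x) (∷ʳ-++ xs y [ z ]))
  (trans (walk-++ H x xs y [ z ]) (cong (walk H x (xs ∷ʳ y) +_) (+-identityʳ _)))

walk≤cycleValue : ∀ (H : Labeling n) x xs → walk H x xs ≤ cycleValue H (x ∷ xs)
walk≤cycleValue H x xs = go x xs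
  where
    go : ∀ y ys → walk H y ys ≤ walk H y (ys ∷ʳ x)
    go y []       = z≤n
    go y (z ∷ ys) = +-monoʳ-≤ ⟦ H y z ⟧ (go z ys)

walk-reverse : ∀ {H : Labeling n} → Symmetric H → ∀ x xs y →
  walk H y (reverse xs ∷ʳ x) ≡ walk H x (xs ∷ʳ y)
walk-reverse {H = H} H-sym x []       y = cong (λ b → ⟦ b ⟧ + 0) (H-sym y x)
walk-reverse {H = H} H-sym x (z ∷ xs) y = begin
  walk H y (reverse (z ∷ xs) ∷ʳ x)       ≡⟨ cong (λ l → walk H y (l ∷ʳ x)) (unfold-reverse z xs) ⟩
  walk H y (reverse xs ∷ʳ z ∷ʳ x)        ≡⟨ walk-∷ʳ∷ʳ H y (reverse xs) z x ⟩
  walk H y (reverse xs ∷ʳ z) + ⟦ H z x ⟧ ≡⟨ cong₂ (λ w b → w + ⟦ b ⟧) (walk-reverse H-sym z xs y) (H-sym z x) ⟩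
  walk H z (xs ∷ʳ y) + ⟦ H x z ⟧         ≡⟨ +-comm (walk H z (xs ∷ʳ y)) _ ⟩
  ⟦ H x z ⟧ + walk H z (xs ∷ʳ y)         ∎
  where open ≡-Reasoning

-- Cut at the heads of the two pieces, both closed walks consist of the same two arcs.
cycleValue-comm : ∀ (H : Labeling n) xs ys → cycleValue H (xs ++ ys) ≡ cycleValue H (ys ++ xs)
cycleValue-comm H []       ys       = cong (cycleValue H) (sym (++-identityʳ ys))
cycleValue-comm H (x ∷ xs) []       = cong (cycleValue H) (++-identityʳ (x ∷ xs))
cycleValue-comm H (x ∷ xs) (y ∷ ys) = begin
  walk H x ((xs ++ y ∷ ys) ∷ʳ x)          ≡⟨ cong (walk H x) (++-assoc xs (y ∷ ys) [ x ]) ⟩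
  walk H x (xs ++ y ∷ (ys ∷ʳ x))          ≡⟨ walk-++ H x xs y (ys ∷ʳ x) ⟩
  walk H x (xs ∷ʳ y) + walk H y (ys ∷ʳ x) ≡⟨ +-comm (walk H x (xs ∷ʳ y)) _ ⟩
  walk H y (ys ∷ʳ x) + walk H x (xs ∷ʳ y) ≡⟨ walk-++ H y ys x (xs ∷ʳ y) ⟨
  walk H y (ys ++ x ∷ (xs ∷ʳ y))          ≡⟨ cong (walk H y) (++-assoc ys (x ∷ xs) [ y ]) ⟨
  walk H y ((ys ++ x ∷ xs) ∷ʳ y)          ∎
  where open ≡-Reasoning

-- Adding an edge and cutting a cycle open at it.

Joins : Fin n → Fin n → Fin n → Fin n → Set
Joins u v i j = (i ≡ u × j ≡ v) ⊎ (i ≡ v × j ≡ u)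

addEdge : Labeling n → Fin n → Fin n → Labeling n
addEdge H u v i j =
  H i j ∨ (does (i Fin.≟ u) ∧ does (j Fin.≟ v) ∨ does (i Fin.≟ v) ∧ does (j Fin.≟ u))

addEdge-cases : ∀ (H : Labeling n) u v i j → addEdge H u v i j ≡ H i j ⊎ Joins u v i j
addEdge-cases H u v i j with i Fin.≟ u | j Fin.≟ v | i Fin.≟ v | j Fin.≟ u
... | yes p | yes q | _     | _     = inj₂ (inj₁ (p , q))
... | _     | _     | yes p | yes q = inj₂ (inj₂ (p , q))
... | yes _ | no _  | yes _ | no _  = inj₁ (Bool.∨-identityʳ _)
... | yes _ | no _  | no _  | _     = inj₁ (Bool.∨-identityʳ _)
... | no _  | _     | yes _ | no _  = inj₁ (Bool.∨-identityʳ _)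
... | no _  | _     | no _  | _     = inj₁ (Bool.∨-identityʳ _)

addEdge-sym : ∀ {H : Labeling n} → Symmetric H → ∀ u v → Symmetric (addEdge H u v)
addEdge-sym H-sym u v i j = cong₂ _∨_ (H-sym i j) (trans
  (cong₂ _∨_ (Bool.∧-comm (does (i Fin.≟ u)) _) (Bool.∧-comm (does (i Fin.≟ v)) _))
  (Bool.∨-comm (does (j Fin.≟ v) ∧ does (i Fin.≟ u)) _))

addEdge-irrefl : ∀ {H : Labeling n} {u v} → Irreflexive H → u ≢ v → Irreflexive (addEdge H u v)
addEdge-irrefl {H = H} {u} {v} H-irr u≢v i with addEdge-cases H u v i i
... | inj₁ eq                 = trans eq (H-irr i)
... | inj₂ (inj₁ (i≡u , i≡v)) = ⊥-elim (u≢v (trans (sym i≡u) i≡v))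
... | inj₂ (inj₂ (i≡v , i≡u)) = ⊥-elim (u≢v (trans (sym i≡u) i≡v))

addEdge-≥ : ∀ (H : Labeling n) u v i j → ⟦ H i j ⟧ ≤ ⟦ addEdge H u v i j ⟧
addEdge-≥ H u v i j with H i j
... | true  = ≤-refl
... | false = z≤n

addEdge-joined : ∀ (H : Labeling n) u v → addEdge H u v u v ≡ true
addEdge-joined H u v with u Fin.≟ u | v Fin.≟ v
... | yes _ | yes _ = Bool.∨-zeroʳ (H u v)
... | no ¬p | _     = ⊥-elim (¬p refl)
... | _     | no ¬p = ⊥-elim (¬p refl)

HasStep : (Fin n → Fin n → Set) → List (Fin n) → Set
HasStep P l = ∃[ xs ] ∃[ y ] ∃[ z ] ∃[ zs ] l ≡ xs ++ y ∷ z ∷ zs × P y z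

HasStep-∷ : ∀ {P : Fin n → Fin n → Set} {x l} → HasStep P l → HasStep P (x ∷ l)
HasStep-∷ {x = x} (xs , y , z , zs , eq , p) = x ∷ xs , y , z , zs , cong (x ∷_) eq , p

addEdge-walk : ∀ (H : Labeling n) u v x xs →
  walk (addEdge H u v) x xs ≤ walk H x xs ⊎ HasStep (Joins u v) (x ∷ xs)
addEdge-walk H u v x []       = inj₁ z≤n
addEdge-walk H u v x (y ∷ ys) with addEdge-cases H u v x y | addEdge-walk H u v y ys
... | inj₂ p  | _       = inj₂ ([] , x , y , ys , refl , p)
... | inj₁ _  | inj₂ st = inj₂ (HasStep-∷ st)
... | inj₁ eq | inj₁ le = inj₁ (+-mono-≤ (≤-reflexive (cong ⟦_⟧ eq)) le)

-- Cutting the closed walk at its step from `p` to `q` makes that step the closing one. The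
-- alternative `xs ≡ []` is the loop of a one-vertex cycle.
rotate : ∀ (H : Labeling n) {P : Fin n → Fin n → Set} x xs → HasStep P (x ∷ (xs ∷ʳ x)) →
  xs ≡ [] ⊎
  ∃[ p ] ∃[ q ] ∃[ ys ] P p q × q ∷ (ys ∷ʳ p) ↭ x ∷ xs ×
    cycleValue H (x ∷ xs) ≡ cycleValue H (q ∷ (ys ∷ʳ p))
rotate H x xs (as , p , q , bs , eq , Ppq) with initLast bs
-- The marked step is already the closing one, so `q` is `x`.
rotate H x xs (as , p , q , _ , eq , Ppq) | []
  with ∷ʳ-injective (x ∷ xs) (as ∷ʳ p) (trans eq (sym (∷ʳ-++ as p [ q ])))
rotate H x xs ([]     , p , q , _ , eq , Ppq) | [] | e , refl = inj₁ (proj₂ (∷-injective e))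
rotate H x xs (a ∷ as , p , q , _ , eq , Ppq) | [] | refl , refl = inj₂ (p , q , as , Ppq , ↭-refl , refl)
rotate H x xs (as , p , q , _ , eq , Ppq) | bs ∷ʳ′ z
  with ∷ʳ-injective (x ∷ xs) (as ++ p ∷ q ∷ bs) (trans eq (sym (++-assoc as (p ∷ q ∷ bs) [ z ])))
... | e , refl = inj₂ (p , q , bs ++ as , Ppq , perm , value)
  where
    split : x ∷ xs ≡ (as ∷ʳ p) ++ (q ∷ bs)
    split = trans e (sym (∷ʳ-++ as p (q ∷ bs)))
    rotated : q ∷ ((bs ++ as) ∷ʳ p) ≡ (q ∷ bs) ++ (as ∷ʳ p)
    rotated = cong (q ∷_) (++-assoc bs as [ p ])
    perm : q ∷ ((bs ++ as) ∷ʳ p) ↭ x ∷ xs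
    perm = subst₂ _↭_ (sym rotated) (sym split) (↭.++-comm (q ∷ bs) (as ∷ʳ p))
    value : cycleValue H (x ∷ xs) ≡ cycleValue H (q ∷ ((bs ++ as) ∷ʳ p))
    value = trans (cong (cycleValue H) split)
      (trans (cycleValue-comm H (as ∷ʳ p) (q ∷ bs)) (cong (cycleValue H) (sym rotated)))

↭-unique : ∀ {l : List (Fin n)} → l ↭ allFin n → Unique l
↭-unique {n} p = ↭ₛ.Unique-resp-↭ (setoid (Fin n)) (↭⇒↭ₛ (↭-sym p)) (allFin⁺ n)

↭-length : ∀ {l : List (Fin n)} → l ↭ allFin n → length l ≡ n
↭-length {n} p = trans (↭.↭-length p) (length-tabulate {n = n} id)

Joins-shared : ∀ {u v p q i j : Fin n} → Joins u v p q → Joins u v i j →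
  (i ≡ p × j ≡ q) ⊎ (i ≡ q × j ≡ p)
Joins-shared (inj₁ (refl , refl)) (inj₁ (refl , refl)) = inj₁ (refl , refl)
Joins-shared (inj₁ (refl , refl)) (inj₂ (refl , refl)) = inj₂ (refl , refl)
Joins-shared (inj₂ (refl , refl)) (inj₁ (refl , refl)) = inj₂ (refl , refl)
Joins-shared (inj₂ (refl , refl)) (inj₂ (refl , refl)) = inj₁ (refl , refl)

addEdge-walk-avoiding : ∀ (H : Labeling n) {u v p q} x xs → Joins u v p q →
  All (q ≢_) (x ∷ xs) → walk (addEdge H u v) x xs ≤ walk H x xs
addEdge-walk-avoiding H x [] J _ = z≤n
addEdge-walk-avoiding H {u} {v} x (y ∷ ys) J (q≢x ∷ q≢y ∷ q≢ys)
  with addEdge-cases H u v x y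
... | inj₁ eq = +-mono-≤ (≤-reflexive (cong ⟦_⟧ eq)) (addEdge-walk-avoiding H y ys J (q≢y ∷ q≢ys))
... | inj₂ J′ with Joins-shared J J′
...   | inj₁ (_ , y≡q) = ⊥-elim (q≢y (sym y≡q))
...   | inj₂ (x≡q , _) = ⊥-elim (q≢x (sym x≡q))

-- The new edge is incident to `q`, which occurs only at the start of the path, and the first step
-- does not lead to `p`. With two vertices it would, hence `3 ≤ n`.
addEdge-path : ∀ (H : Labeling n) {u v p q} ys → Joins u v p q → 3 ≤ n →
  q ∷ (ys ∷ʳ p) ↭ allFin n → walk (addEdge H u v) q (ys ∷ʳ p) ≤ walk H q (ys ∷ʳ p)
addEdge-path H [] J 3≤n perm with ↭-length perm
... | refl with 3≤n
...   | s≤s (s≤s ())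
addEdge-path H {u} {v} {p} {q} (m ∷ ys) J 3≤n perm with ↭-unique perm
... | (q≢m ∷ q≢ys) ∷ m≢ys ∷ _ with addEdge-cases H u v q m
...   | inj₁ eq = +-mono-≤ (≤-reflexive (cong ⟦_⟧ eq)) (addEdge-walk-avoiding H m (ys ∷ʳ p) J (q≢m ∷ q≢ys))
...   | inj₂ J′ with Joins-shared J J′
...     | inj₁ (_ , m≡q) = ⊥-elim (q≢m (sym m≡q))
...     | inj₂ (_ , m≡p) = ⊥-elim (proj₂ (All.∷ʳ⁻ m≢ys) m≡p)

-- The exchange argument and the closure step.

HamiltonianList : Labeling n → ℕ → Set
HamiltonianList {n} H k = ∃[ l ] l ↭ allFin n × k ≤ cycleValue H l

module _ {H : Labeling n} (H-sym : Symmetric H) (H-irr : Irreflexive H) where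

  -- On a cycle q ... s t ... p with `p`, `q` non-adjacent, replacing the edges pq and st by ps and
  -- qt gains at least one.
  Improving : Fin n → Fin n → Fin n → Fin n → Set
  Improving p q s t = ⟦ H s t ⟧ < ⟦ H p s ⟧ + ⟦ H q t ⟧

  -- If no step improves, the reverse inequalities add up along the path: `s` runs over all entries
  -- but the last, `t` over all but the first. Including `p` in its own sum is harmless, as `H` is
  -- irreflexive.
  improving-step : ∀ p q x xs → HasStep (Improving p q) (x ∷ (xs ∷ʳ p)) ⊎
    ∑ (x ∷ (xs ∷ʳ p)) (λ y → ⟦ H p y ⟧) + ∑ (xs ∷ʳ p) (λ y → ⟦ H q y ⟧) ≤ walk H x (xs ∷ʳ p)
  improving-step p q x [] with ⟦ H x p ⟧ <? ⟦ H p x ⟧ + ⟦ H q p ⟧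
  ... | yes lt = inj₁ ([] , x , p , [] , refl , lt)
  ... | no ≮ rewrite H-irr p = inj₂ (begin
    ⟦ H p x ⟧ + 0 + (⟦ H q p ⟧ + 0) ≡⟨ cong₂ _+_ (+-identityʳ ⟦ H p x ⟧) (+-identityʳ ⟦ H q p ⟧) ⟩
    ⟦ H p x ⟧ + ⟦ H q p ⟧           ≤⟨ ≮⇒≥ ≮ ⟩
    ⟦ H x p ⟧                       ≡⟨ +-identityʳ _ ⟨
    ⟦ H x p ⟧ + 0                   ∎)
    where open ≤-Reasoning
  improving-step p q x (m ∷ xs)
    with ⟦ H x m ⟧ <? ⟦ H p x ⟧ + ⟦ H q m ⟧ | improving-step p q m xs
  ... | yes lt | _       = inj₁ ([] , x , m , xs ∷ʳ p , refl , lt)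
  ... | no _   | inj₁ st = inj₁ (HasStep-∷ st)
  ... | no ≮   | inj₂ le = inj₂ (begin
    ⟦ H p x ⟧ + a + (⟦ H q m ⟧ + b)  ≡⟨ lemma ⟦ H p x ⟧ a ⟦ H q m ⟧ b ⟩
    ⟦ H p x ⟧ + ⟦ H q m ⟧ + (a + b)  ≤⟨ +-mono-≤ (≮⇒≥ ≮) le ⟩
    ⟦ H x m ⟧ + walk H m (xs ∷ʳ p)   ∎)
    where
      open ≤-Reasoning
      a = ∑ (m ∷ (xs ∷ʳ p)) (λ y → ⟦ H p y ⟧)
      b = ∑ (xs ∷ʳ p) (λ y → ⟦ H q y ⟧)
      lemma : ∀ s a t b → s + a + (t + b) ≡ s + t + (a + b)
      lemma = solve-∀

  exchange : ∀ {k p q} xs → H p q ≡ false → k ≤ suc (walk H q (xs ∷ʳ p)) →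
    HasStep (Improving p q) (q ∷ (xs ∷ʳ p)) →
    ∃[ l ] l ↭ q ∷ (xs ∷ʳ p) × k ≤ cycleValue H l
  -- The first step, with `s` equal to `q`, cannot improve since `H p q` is false. The last one,
  -- with `t` equal to `p`, is excluded next in the same way.
  exchange {k} {p} {q} xs Hpq k≤ ([] , s , t , B , eq , lt) with ∷-injective eq
  ... | refl , _ rewrite Hpq = ⊥-elim (<-irrefl refl lt)
  exchange {k} {p} {q} xs Hpq k≤ (a ∷ A , s , t , B , eq , lt) with ∷-injective eq | initLast B
  ... | refl , eq′ | []
    with ∷ʳ-injective xs (A ∷ʳ s) (trans eq′ (sym (∷ʳ-++ A s [ t ])))
  ...   | refl , refl rewrite H-sym q p | Hpq | H-sym s p | +-identityʳ ⟦ H p s ⟧ = ⊥-elim (<-irrefl refl lt)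
  exchange {k} {p} {q} xs Hpq k≤ (a ∷ A , s , t , _ , eq , lt) | refl , eq′ | B ∷ʳ′ z
    with ∷ʳ-injective xs (A ++ s ∷ t ∷ B) (trans eq′ (sym (++-assoc A (s ∷ t ∷ B) [ z ])))
  -- The path is q A s t B p; the new cycle runs from `s` back through the reversed `A` to `q`, then
  -- jumps to `t`, follows `B` to `p` and closes at `s`.
  ... | refl , refl = s ∷ (reverse (q ∷ A) ++ X) , perm , (begin
      k
        ≤⟨ k≤ ⟩
      suc (walk H q ((A ++ s ∷ t ∷ B) ∷ʳ p))
        ≡⟨ cong suc (trans (cong (walk H q) (++-assoc A (s ∷ t ∷ B) [ p ])) (walk-++ H q A s X)) ⟩
      suc (walk H q (A ∷ʳ s) + (⟦ H s t ⟧ + w))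
        ≡⟨ lemma₁ (walk H q (A ∷ʳ s)) ⟦ H s t ⟧ w ⟩
      suc ⟦ H s t ⟧ + (walk H q (A ∷ʳ s) + w)
        ≤⟨ +-monoˡ-≤ _ lt ⟩
      ⟦ H p s ⟧ + ⟦ H q t ⟧ + (walk H q (A ∷ʳ s) + w)
        ≡⟨ lemma₂ ⟦ H p s ⟧ ⟦ H q t ⟧ _ w ⟩
      walk H q (A ∷ʳ s) + (⟦ H q t ⟧ + (w + ⟦ H p s ⟧))
        ≡⟨ cong₂ (λ a b → a + (⟦ H q t ⟧ + b)) (walk-reverse H-sym q A s) (walk-∷ʳ∷ʳ H t B p s) ⟨
      walk H s (reverse A ∷ʳ q) + (⟦ H q t ⟧ + walk H t (B ∷ʳ p ∷ʳ s))
        ≡⟨ walk-++ H s (reverse A) q (X ∷ʳ s) ⟨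
      walk H s (reverse A ++ q ∷ (X ∷ʳ s))
        ≡⟨ cong (walk H s) (sym (∷ʳ-++ (reverse A) q (X ∷ʳ s))) ⟩
      walk H s ((reverse A ∷ʳ q) ++ (X ∷ʳ s))
        ≡⟨ cong (λ l → walk H s (l ++ (X ∷ʳ s))) (unfold-reverse q A) ⟨
      walk H s (reverse (q ∷ A) ++ (X ∷ʳ s))
        ≡⟨ cong (walk H s) (++-assoc (reverse (q ∷ A)) X [ s ]) ⟨
      walk H s ((reverse (q ∷ A) ++ X) ∷ʳ s) ∎)
    where
      open ≤-Reasoning
      X = t ∷ (B ∷ʳ p)
      w = walk H t (B ∷ʳ p)
      lemma₁ : ∀ a b c → suc (a + (b + c)) ≡ suc b + (a + c)
      lemma₁ = solve-∀
      lemma₂ : ∀ a b c d → a + b + (c + d) ≡ c + (b + (d + a))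
      lemma₂ = solve-∀
      perm : s ∷ (reverse (q ∷ A) ++ X) ↭ q ∷ ((A ++ s ∷ t ∷ B) ∷ʳ p)
      perm = subst (λ l → s ∷ (reverse (q ∷ A) ++ X) ↭ q ∷ l) (sym (++-assoc A (s ∷ t ∷ B) [ p ]))
        (↭-trans (prep s (↭.++⁺ʳ X (↭.↭-reverse (q ∷ A)))) (↭-sym (↭.shift s (q ∷ A) X)))

  -- Either some step improves and the exchange makes up for the missing edge pq, or the path alone
  -- already has value at least `deg H p + deg H q`.
  two-opt : ∀ {k p q} xs → H p q ≡ false → k ≤ deg H p + deg H q → k ≤ suc (walk H q (xs ∷ʳ p)) →
    q ∷ (xs ∷ʳ p) ↭ allFin n → HamiltonianList H k
  two-opt {k} {p} {q} xs Hpq k≤deg k≤walk perm with improving-step p q q xs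
  ... | inj₁ st = let l , l↭ , k≤ = exchange xs Hpq k≤walk st in l , ↭-trans l↭ perm , k≤
  ... | inj₂ le = q ∷ (xs ∷ʳ p) , perm , (begin
    k                  ≤⟨ k≤deg ⟩
    deg H p + deg H q  ≡⟨ cong₂ _+_ (∑-↭ (λ y → ⟦ H p y ⟧) perm) (∑-↭ (λ y → ⟦ H q y ⟧) perm) ⟨
    ∑ (q ∷ (xs ∷ʳ p)) (λ y → ⟦ H p y ⟧) + (⟦ H q q ⟧ + ∑ (xs ∷ʳ p) (λ y → ⟦ H q y ⟧))
      ≡⟨ cong (λ b → ∑ (q ∷ (xs ∷ʳ p)) (λ y → ⟦ H p y ⟧) + (⟦ b ⟧ + ∑ (xs ∷ʳ p) (λ y → ⟦ H q y ⟧))) (H-irr q) ⟩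
    ∑ (q ∷ (xs ∷ʳ p)) (λ y → ⟦ H p y ⟧) + ∑ (xs ∷ʳ p) (λ y → ⟦ H q y ⟧)
      ≤⟨ le ⟩
    walk H q (xs ∷ʳ p)
      ≤⟨ walk≤cycleValue H q (xs ∷ʳ p) ⟩
    cycleValue H (q ∷ (xs ∷ʳ p)) ∎)
    where open ≤-Reasoning

  -- A cycle through the new edge is rotated until that edge closes it. Dropping the edge loses at
  -- most one, and the rest is a path whose value in `H` is at least `k` minus one, ready for
  -- `two-opt`.
  closure : ∀ {k u v} → 3 ≤ n → H u v ≡ false → k ≤ deg H u + deg H v →
    HamiltonianList (addEdge H u v) k → HamiltonianList H k
  closure 3≤n Huv k≤deg ([] , perm , k≤) = [] , perm , k≤
  closure {k} {u} {v} 3≤n Huv k≤deg (x ∷ xs , perm , k≤) with addEdge-walk H u v x (xs ∷ʳ x)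
  ... | inj₁ le = x ∷ xs , perm , ≤-trans k≤ le
  ... | inj₂ st with rotate (addEdge H u v) x xs st
  ...   | inj₁ refl with ↭-length perm | 3≤n
  ...     | refl | s≤s ()
  closure {k} {u} {v} 3≤n Huv k≤deg (x ∷ xs , perm , k≤) | inj₂ st | inj₂ (p , q , ys , J , p↭ , value) =
    two-opt ys (Hpq J) (≤-trans k≤deg (deg≤ J)) k≤suc perm′
    where
      open ≤-Reasoning
      H′ = addEdge H u v
      perm′ = ↭-trans p↭ perm
      Hpq : Joins u v p q → H p q ≡ false
      Hpq (inj₁ (refl , refl)) = Huv
      Hpq (inj₂ (refl , refl)) = trans (H-sym v u) Huv
      deg≤ : Joins u v p q → deg H u + deg H v ≤ deg H p + deg H q
      deg≤ (inj₁ (refl , refl)) = ≤-refl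
      deg≤ (inj₂ (refl , refl)) = ≤-reflexive (+-comm (deg H u) _)
      k≤suc : k ≤ suc (walk H q (ys ∷ʳ p))
      k≤suc = begin
        k                                    ≤⟨ k≤ ⟩
        cycleValue H′ (x ∷ xs)               ≡⟨ value ⟩
        walk H′ q (ys ∷ʳ p ∷ʳ q)             ≡⟨ walk-∷ʳ∷ʳ H′ q ys p q ⟩
        walk H′ q (ys ∷ʳ p) + ⟦ H′ p q ⟧     ≤⟨ +-mono-≤ (addEdge-path H ys J 3≤n perm′) (⟦⟧≤1 (H′ p q)) ⟩
        walk H q (ys ∷ʳ p) + 1               ≡⟨ +-comm _ 1 ⟩
        suc (walk H q (ys ∷ʳ p))             ∎

-- Degree counting in closed graphs

∑-mono-< : ∀ {f g : A → ℕ} {x xs} → (∀ y → f y ≤ g y) → x ∈ xs → f x < g x → ∑ xs f < ∑ xs g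
∑-mono-< f≤g (here {xs = xs} refl) fx<gx = +-mono-<-≤ fx<gx (∑-mono xs f≤g)
∑-mono-< f≤g (there {x = y} x∈xs)  fx<gx = +-mono-≤-< (f≤g y) (∑-mono-< f≤g x∈xs fx<gx)

∑∑-mono : ∀ {f g : Fin n → Fin n → ℕ} → (∀ i j → f i j ≤ g i j) → ∑∑ f ≤ ∑∑ g
∑∑-mono {n} h = ∑-mono (allFin n) (λ i → ∑-mono (allFin n) (h i))

deg≤n : ∀ (H : Labeling n) i → deg H i ≤ n
deg≤n {n} H i = ≤-trans (∑-mono (allFin n) (λ j → ⟦⟧≤1 (H i j)))
  (≤-reflexive (trans (∑-allFin-const n 1) (*-identityʳ n)))

degSum≤n² : ∀ (H : Labeling n) → degSum H ≤ n * n
degSum≤n² {n} H = ≤-trans (∑-mono (allFin n) (deg≤n H)) (≤-reflexive (∑-allFin-const n n))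

-- The entry at (`u`, `v`) grows strictly. This makes `degSum` the measure that terminates the
-- closure iteration.
degSum-addEdge : ∀ (H : Labeling n) u v → H u v ≡ false → degSum H < degSum (addEdge H u v)
degSum-addEdge {n} H u v Huv =
  ∑-mono-< (λ i → ∑-mono (allFin n) (addEdge-≥ H u v i)) (∈-allFin u)
    (∑-mono-< (addEdge-≥ H u v u) (∈-allFin v)
      (subst₂ (λ a b → ⟦ a ⟧ < ⟦ b ⟧) (sym Huv) (sym (addEdge-joined H u v)) ≤-refl))

-- The first hypothesis reads 2D ≤ nm + w(2n - m). Inserting 2w ≤ m + 2 gives 4D ≤ 4nm - m² + 4n -
-- 2m.
few-high-bound : ∀ D w m n → D + D + w * m ≤ n * m + w * (n + n) → w + w ≤ m + 2 → m ≤ n →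
  4 * D + m * m ≤ 4 * (n * m) + 12 * n
few-high-bound D w m n D≤ w≤ m≤n with m≤n⇒∃[o]m+o≡n m≤n
-- With n = m + q the factor 2n - m becomes `m + 2 * q`, free of subtraction.
... | q , refl = begin
  4 * D + m * m                                   ≡⟨ lemma₀ D m ⟩
  (D + D) + (D + D) + m * m                       ≤⟨ +-monoˡ-≤ (m * m) (+-mono-≤ 2D≤ 2D≤) ⟩
  ((m + q) * m + w * (m + 2 * q)) + ((m + q) * m + w * (m + 2 * q)) + m * m
                                                  ≡⟨ lemma₁ m q w ⟩
  2 * ((m + q) * m) + m * m + (w + w) * (m + 2 * q)
    ≤⟨ +-monoʳ-≤ (2 * ((m + q) * m) + m * m) (*-monoˡ-≤ (m + 2 * q) w≤) ⟩
  2 * ((m + q) * m) + m * m + (m + 2) * (m + 2 * q)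
    ≤⟨ m≤m+n _ (10 * m + 8 * q) ⟩
  2 * ((m + q) * m) + m * m + (m + 2) * (m + 2 * q) + (10 * m + 8 * q)
    ≡⟨ lemma₂ m q ⟩
  4 * ((m + q) * m) + 12 * (m + q)                ∎
  where
    open ≤-Reasoning
    lemma₀ : ∀ D m → 4 * D + m * m ≡ (D + D) + (D + D) + m * m
    lemma₀ = solve-∀
    lemma₁ : ∀ m q w → ((m + q) * m + w * (m + 2 * q)) + ((m + q) * m + w * (m + 2 * q)) + m * m
      ≡ 2 * ((m + q) * m) + m * m + (w + w) * (m + 2 * q)
    lemma₁ = solve-∀
    lemma₂ : ∀ m q → 2 * ((m + q) * m) + m * m + (m + 2) * (m + 2 * q) + (10 * m + 8 * q)
      ≡ 4 * ((m + q) * m) + 12 * (m + q)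
    lemma₂ = solve-∀
    lemma₃ : ∀ m q w → (m + q) * m + w * (m + q + (m + q)) ≡ (m + q) * m + w * (m + 2 * q) + w * m
    lemma₃ = solve-∀
    2D≤ : D + D ≤ (m + q) * m + w * (m + 2 * q)
    2D≤ = +-cancelʳ-≤ (w * m) _ _ (≤-trans D≤ (≤-reflexive (lemma₃ m q w)))

-- With f = a - e and n = p + 1 + a, the difference of the two sides is
-- f (4p - f) up to linear terms, and 5m ≤ 4n says f + 6e ≤ 4p + 4.
many-high-bound : ∀ D p a e → D ≤ suc a * suc a + 2 * (p * e) → e ≤ a →
  5 * (a + e) ≤ 4 * (p + suc a) →
  4 * D + (a + e) * (a + e) ≤ 4 * ((p + suc a) * (a + e)) + 12 * (p + suc a)
many-high-bound D p a e D≤ e≤a 5m≤4n with m≤n⇒∃[o]m+o≡n e≤a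
... | f , refl = +-cancelʳ-≤ (f * f) _ _ (begin
  4 * D + (a + e) * (a + e) + f * f
    ≤⟨ +-mono-≤ (+-monoˡ-≤ _ (*-monoʳ-≤ 4 D≤)) (*-monoˡ-≤ f f≤) ⟩
  4 * (suc a * suc a + 2 * (p * e)) + (a + e) * (a + e) + (4 * p + 4) * f
    ≤⟨ m≤m+n _ (4 * f + 12 * e + 12 * p + 8) ⟩
  4 * (suc a * suc a + 2 * (p * e)) + (a + e) * (a + e) + (4 * p + 4) * f + (4 * f + 12 * e + 12 * p + 8)
    ≡⟨ lemma₁ p e f ⟩
  4 * ((p + suc a) * (a + e)) + 12 * (p + suc a) + f * f ∎)
  where
    open ≤-Reasoning
    lemma₁ : ∀ p e f → let a = e + f in
      4 * (suc a * suc a + 2 * (p * e)) + (a + e) * (a + e) + (4 * p + 4) * f + (4 * f + 12 * e + 12 * p + 8)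
        ≡ 4 * ((p + suc a) * (a + e)) + 12 * (p + suc a) + f * f
    lemma₁ = solve-∀
    lemma₂ : ∀ e f → 5 * (e + f + e) ≡ f + 6 * e + 4 * (e + f)
    lemma₂ = solve-∀
    lemma₃ : ∀ p e f → 4 * (p + suc (e + f)) ≡ 4 * p + 4 + 4 * (e + f)
    lemma₃ = solve-∀
    f≤ : f ≤ 4 * p + 4
    f≤ = ≤-trans (m≤m+n f (6 * e))
      (+-cancelʳ-≤ (4 * (e + f)) _ _ (subst₂ _≤_ (lemma₂ e f) (lemma₃ p e f) 5m≤4n))

module Counting {H : Labeling n} (H-sym : Symmetric H) {m : ℕ}
  (ore : ∀ i j → i ≢ j → H i j ≡ false → deg H i + deg H j ≤ m)
  (5m≤4n : 5 * m ≤ 4 * n) where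

  -- The threshold is degree m/2, doubled to stay within ℕ.
  high low : Fin n → Bool
  high i = m <ᵇ deg H i + deg H i
  low i = not (high i)

  high-deg : ∀ i → high i ≡ true → m < deg H i + deg H i
  high-deg i eq = <ᵇ⇒< m _ (subst T (sym eq) _)

  low-deg : ∀ i → high i ≡ false → deg H i + deg H i ≤ m
  low-deg i eq = ≮⇒≥ λ m< → case (trans (sym (<ᵇ-true m<)) eq)
    where
      case : true ≢ false
      case ()

  w p : ℕ
  w = count high
  p = count low

  p+w≡n : p + w ≡ n
  p+w≡n = begin
    p + w                                         ≡⟨ ∑-+ (allFin n) ⟨
    ∑ (allFin n) (λ i → ⟦ low i ⟧ + ⟦ high i ⟧)   ≡⟨ ∑-cong (allFin n) (λ i → one (high i)) ⟩
    ∑ (allFin n) (λ _ → 1)                        ≡⟨ ∑-allFin-const n 1 ⟩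
    n * 1                                         ≡⟨ *-identityʳ n ⟩
    n                                             ∎
    where
      open ≡-Reasoning
      one : ∀ b → ⟦ not b ⟧ + ⟦ b ⟧ ≡ 1
      one true  = refl
      one false = refl

  m≤n : m ≤ n
  m≤n = *-cancelˡ-≤ 4 (≤-trans (*-monoˡ-≤ m (n≤1+n 4)) 5m≤4n)

  -- Two non-adjacent high vertices would have degree sum above `m`, against `ore`.
  high-clique : ∀ i j → i ≢ j → high i ≡ true → high j ≡ true → H i j ≡ true
  high-clique i j i≢j hi hj with H i j in Hij
  ... | true  = refl
  ... | false = ⊥-elim (<⇒≱ (+-mono-< (high-deg i hi) (high-deg j hj)) (begin
    deg H i + deg H i + (deg H j + deg H j) ≡⟨ lemma (deg H i) (deg H j) ⟩
    deg H i + deg H j + (deg H i + deg H j) ≤⟨ +-mono-≤ (ore i j i≢j Hij) (ore i j i≢j Hij) ⟩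
    m + m                                   ∎))
    where
      open ≤-Reasoning
      lemma : ∀ a b → a + a + (b + b) ≡ a + b + (a + b)
      lemma = solve-∀

  few-high : w + w ≤ m + 2 → 4 * degSum H + m * m ≤ 4 * (n * m) + 12 * n
  few-high w≤ = few-high-bound (degSum H) w m n total w≤ m≤n
    where
      open ≤-Reasoning
      -- Twice the degree is at most `m` at a low vertex and at most 2n at a high one. The right
      -- side grants `m` to every vertex, so the left side gives it back at the high ones.
      vertex : ∀ i → deg H i + deg H i + ⟦ high i ⟧ * m ≤ m + ⟦ high i ⟧ * (n + n)
      vertex i with high i in eq
      ... | false = +-monoˡ-≤ 0 (low-deg i eq)
      ... | true  = begin
        deg H i + deg H i + (m + 0) ≡⟨ +-comm (deg H i + deg H i) _ ⟩
        m + 0 + (deg H i + deg H i) ≤⟨ +-mono-≤ (≤-reflexive (+-identityʳ m)) (+-mono-≤ (deg≤n H i) (deg≤n H i)) ⟩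
        m + (n + n)                 ≡⟨ cong (m +_) (+-identityʳ (n + n)) ⟨
        m + (n + n + 0)             ∎
      total : degSum H + degSum H + w * m ≤ n * m + w * (n + n)
      total = begin
        degSum H + degSum H + w * m
          ≡⟨ cong₂ _+_ (sym (∑-+ (allFin n))) (sym (∑-*ʳ (allFin n) m)) ⟩
        ∑ (allFin n) (λ i → deg H i + deg H i) + ∑ (allFin n) (λ i → ⟦ high i ⟧ * m)
          ≡⟨ ∑-+ (allFin n) ⟨
        ∑ (allFin n) (λ i → deg H i + deg H i + ⟦ high i ⟧ * m)
          ≤⟨ ∑-mono (allFin n) vertex ⟩
        ∑ (allFin n) (λ i → m + ⟦ high i ⟧ * (n + n))
          ≡⟨ ∑-+ (allFin n) ⟩
        ∑ (allFin n) (λ _ → m) + ∑ (allFin n) (λ i → ⟦ high i ⟧ * (n + n))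
          ≡⟨ cong₂ _+_ (∑-allFin-const n m) (∑-*ʳ (allFin n) (n + n)) ⟩
        n * m + w * (n + n) ∎

  module ManyHigh {a : ℕ} (w≡ : w ≡ suc a) (m+2<2w : m + 2 < w + w) where

    -- A high vertex is adjacent to the other `a` members of the clique; the indicator of `j` itself
    -- accounts for the difference between `w` and `a`.
    high-deg-≥ : ∀ j → high j ≡ true → a ≤ deg H j
    high-deg-≥ j hj = ≤-pred (begin
      suc a                                               ≡⟨ w≡ ⟨
      w                                                   ≤⟨ ∑-mono (allFin n) bound ⟩
      ∑ (allFin n) (λ i → ⟦ does (j Fin.≟ i) ⟧ + ⟦ H j i ⟧) ≡⟨ ∑-+ (allFin n) ⟩
      ∑ (allFin n) (λ i → ⟦ does (j Fin.≟ i) ⟧) + deg H j ≡⟨ cong (_+ deg H j) (∑-indicator j) ⟩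
      suc (deg H j)                                       ∎)
      where
        open ≤-Reasoning
        bound : ∀ i → ⟦ high i ⟧ ≤ ⟦ does (j Fin.≟ i) ⟧ + ⟦ H j i ⟧
        bound i with high i in hi | j Fin.≟ i
        ... | false | _       = z≤n
        ... | true  | yes _   = s≤s z≤n
        ... | true  | no j≢i rewrite high-clique j i j≢i hj hi = ≤-refl

    -- If `i` misses a high vertex `j`, then `ore` and the degree of `j` give the bound. A low
    -- vertex adjacent to every high one would have degree at least `w`, too large since 2w > m + 2.
    low-deg-≤ : ∀ i → high i ≡ false → deg H i + a ≤ m
    low-deg-≤ i li with Fin.any? (λ j → (high j Bool.≟ true) ×-dec (H i j Bool.≟ false))
    ... | yes (j , hj , Hij) = ≤-trans (+-monoʳ-≤ (deg H i) (high-deg-≥ j hj)) (ore i j i≢j Hij)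
      where
        i≢j : i ≢ j
        i≢j refl with trans (sym hj) li
        ... | ()
    ... | no none = ⊥-elim (<⇒≱ m+2<2w (begin
      w + w             ≤⟨ +-mono-≤ w≤deg w≤deg ⟩
      deg H i + deg H i ≤⟨ low-deg i li ⟩
      m                 ≤⟨ m≤m+n m 2 ⟩
      m + 2             ∎))
      where
        open ≤-Reasoning
        bound : ∀ j → ⟦ high j ⟧ ≤ ⟦ H i j ⟧
        bound j with high j in hj | H i j in Hij
        ... | false | _     = z≤n
        ... | true  | true  = ≤-refl
        ... | true  | false = ⊥-elim (none (j , hj , Hij))
        w≤deg : w ≤ deg H i
        w≤deg = ∑-mono (allFin n) bound

    -- With m = a + e, every low vertex has degree at most `e`. In the adjacency matrix the block of
    -- high rows and columns contributes at most (a + 1)², and every other entry lies in a low row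
    -- or a low column, each kind contributing at most `p * e`.
    many-high : ∀ i → high i ≡ false → 4 * degSum H + m * m ≤ 4 * (n * m) + 12 * n
    -- The low vertex `i₀` shows `a ≤ m`, so that `e` exists as a natural number.
    many-high i₀ li₀ with m≤n⇒∃[o]m+o≡n (m+n≤o⇒n≤o (deg H i₀) (low-deg-≤ i₀ li₀))
    ... | e , a+e≡m = subst₂ (λ m n → 4 * degSum H + m * m ≤ 4 * (n * m) + 12 * n) a+e≡m p+suca≡n
      (many-high-bound (degSum H) p a e total e≤a
        (subst₂ (λ m n → 5 * m ≤ 4 * n) (sym a+e≡m) (sym p+suca≡n) 5m≤4n))
      where
        open ≤-Reasoning
        p+suca≡n : p + suc a ≡ n
        p+suca≡n = trans (cong (p +_) (sym w≡)) p+w≡n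
        lemma : ∀ a → suc a + suc a ≡ a + (a + 2)
        lemma = solve-∀
        e≤a : e ≤ a
        e≤a = +-cancelˡ-≤ a _ _ (+-cancelʳ-≤ 2 _ _ (begin
          a + e + 2       ≡⟨ cong (_+ 2) a+e≡m ⟩
          m + 2           ≤⟨ <⇒≤ m+2<2w ⟩
          w + w           ≡⟨ cong₂ _+_ w≡ w≡ ⟩
          suc a + suc a   ≡⟨ lemma a ⟩
          a + (a + 2)     ≡⟨ +-assoc a a 2 ⟨
          a + a + 2       ∎))
        highhigh lowrow lowcol : Fin n → Fin n → ℕ
        highhigh i j = ⟦ high j ⟧ * ⟦ high i ⟧
        lowrow i j = ⟦ H i j ⟧ * ⟦ low i ⟧
        lowcol i j = ⟦ H i j ⟧ * ⟦ low j ⟧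
        entry : ∀ i j → ⟦ H i j ⟧ ≤ highhigh i j + (lowrow i j + lowcol i j)
        entry i j with H i j | high i | high j
        ... | false | _     | _     = z≤n
        ... | true  | true  | true  = ≤-refl
        ... | true  | true  | false = ≤-refl
        ... | true  | false | true  = ≤-refl
        ... | true  | false | false = s≤s z≤n
        ∑∑-highhigh : ∑∑ highhigh ≡ suc a * suc a
        ∑∑-highhigh = begin-equality
          ∑∑ highhigh                                ≡⟨ ∑-cong (allFin n) (λ i → ∑-*ʳ (allFin n) ⟦ high i ⟧) ⟩
          ∑ (allFin n) (λ i → w * ⟦ high i ⟧)        ≡⟨ ∑-cong (allFin n) (λ i → *-comm w ⟦ high i ⟧) ⟩
          ∑ (allFin n) (λ i → ⟦ high i ⟧ * w)        ≡⟨ ∑-*ʳ (allFin n) w ⟩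
          w * w                                      ≡⟨ cong₂ _*_ w≡ w≡ ⟩
          suc a * suc a                              ∎
        low-weight : ∀ i → deg H i * ⟦ low i ⟧ ≤ ⟦ low i ⟧ * e
        low-weight i with high i in li
        ... | true  = ≤-reflexive (*-zeroʳ (deg H i))
        ... | false = begin
          deg H i * 1 ≡⟨ *-identityʳ (deg H i) ⟩
          deg H i     ≤⟨ +-cancelʳ-≤ a _ _ (≤-trans (low-deg-≤ i li) (≤-reflexive (trans (sym a+e≡m) (+-comm a e)))) ⟩
          e           ≡⟨ +-identityʳ e ⟨
          e + 0       ∎
        ∑∑-lowrow : ∑∑ lowrow ≤ p * e
        ∑∑-lowrow = begin
          ∑∑ lowrow                               ≡⟨ ∑-cong (allFin n) (λ i → ∑-*ʳ (allFin n) ⟦ low i ⟧) ⟩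
          ∑ (allFin n) (λ i → deg H i * ⟦ low i ⟧) ≤⟨ ∑-mono (allFin n) low-weight ⟩
          ∑ (allFin n) (λ i → ⟦ low i ⟧ * e)      ≡⟨ ∑-*ʳ (allFin n) e ⟩
          p * e                                   ∎
        ∑∑-lowcol : ∑∑ lowcol ≡ ∑∑ lowrow
        ∑∑-lowcol = trans (∑-swap (allFin n) (allFin n) lowcol)
          (∑∑-cong (λ i j → cong (λ b → ⟦ b ⟧ * ⟦ low i ⟧) (H-sym j i)))
        total : degSum H ≤ suc a * suc a + 2 * (p * e)
        total = begin
          degSum H                                                 ≤⟨ ∑∑-mono entry ⟩
          ∑∑ (λ i j → highhigh i j + (lowrow i j + lowcol i j))    ≡⟨ ∑∑-+ highhigh _ ⟩
          ∑∑ highhigh + ∑∑ (λ i j → lowrow i j + lowcol i j)       ≡⟨ cong₂ _+_ ∑∑-highhigh (∑∑-+ lowrow lowcol) ⟩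
          suc a * suc a + (∑∑ lowrow + ∑∑ lowcol)
            ≤⟨ +-monoʳ-≤ (suc a * suc a) (+-mono-≤ ∑∑-lowrow (≤-trans (≤-reflexive ∑∑-lowcol) ∑∑-lowrow)) ⟩
          suc a * suc a + (p * e + p * e)
            ≡⟨ cong (λ x → suc a * suc a + (p * e + x)) (+-identityʳ (p * e)) ⟨
          suc a * suc a + 2 * (p * e) ∎

  complete-or-sparse : (∀ i j → i ≢ j → H i j ≡ true) ⊎ 4 * degSum H + m * m ≤ 4 * (n * m) + 12 * n
  complete-or-sparse with w + w ≤? m + 2
  ... | yes w≤ = inj₂ (few-high w≤)
  ... | no w≰ with Fin.any? (λ i → high i Bool.≟ false) | w in w≡
  ...   | yes _         | zero  = ⊥-elim (w≰ z≤n)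
  ...   | yes (i , li)  | suc a = inj₂ (ManyHigh.many-high w≡ (subst (λ w → m + 2 < w + w) (sym w≡) (≰⇒> w≰)) i li)
  -- Without low vertices the clique of high vertices is the whole graph.
  ...   | no none       | _     = inj₁ (λ i j i≢j → high-clique i j i≢j (all-high i) (all-high j))
    where
      all-high : ∀ i → high i ≡ true
      all-high i with high i in eq
      ... | true  = refl
      ... | false = ⊥-elim (none (i , eq))

-- Complete graphs and the iteration of the closure.

complete-walk : ∀ {H : Labeling n} → (∀ i j → i ≢ j → H i j ≡ true) →
  ∀ x xs → Unique (x ∷ xs) → walk H x xs ≡ length xs
complete-walk complete x []       _ = refl
complete-walk complete x (y ∷ ys) ((x≢y ∷ _) ∷ unique) =
  cong₂ _+_ (cong ⟦_⟧ (complete x y x≢y)) (complete-walk complete y ys unique)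

-- Any vertex order works. Only the n - 1 steps of the path are counted and not the closing edge,
-- hence `suc k ≤ n`.
complete-hamiltonian : ∀ {H : Labeling n} {k} → (∀ i j → i ≢ j → H i j ≡ true) → suc k ≤ n →
  HamiltonianList H k
complete-hamiltonian {suc n} {H} {k} complete k≤ = allFin (suc n) , ↭-refl , (begin
  k                                    ≤⟨ ≤-pred k≤ ⟩
  n                                    ≡⟨ suc-injective (↭-length (↭-refl {x = allFin (suc n)})) ⟨
  length vs                            ≡⟨ complete-walk complete zero vs (↭-unique ↭-refl) ⟨
  walk H zero vs                       ≤⟨ walk≤cycleValue H zero vs ⟩
  cycleValue H (allFin (suc n))        ∎)
  where
    open ≤-Reasoning
    vs : List (Fin (suc n))
    vs = tabulate suc

dense-hamiltonian : ∀ {H : Labeling n} {m} → Symmetric H → Irreflexive H → 3 ≤ n →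
  5 * m ≤ 4 * n → 2 + m ≤ n → 4 * (n * m) + 12 * n < 4 * degSum H + m * m →
  HamiltonianList H (suc m)
dense-hamiltonian {n} {H} {m} H-sym H-irr 3≤n 5m≤4n 2+m≤n dense =
  go (n * n) H-sym H-irr (m≤n+m (n * n) (degSum H)) dense
  where
    -- `fuel` bounds the number of edge insertions still possible, because a degree sum never
    -- exceeds `n * n`.
    go : ∀ fuel {H : Labeling n} → Symmetric H → Irreflexive H → n * n ≤ degSum H + fuel →
      4 * (n * m) + 12 * n < 4 * degSum H + m * m → HamiltonianList H (suc m)
    go fuel {H} H-sym H-irr fuel≥ dense
      with Fin.any? (λ u → Fin.any? (λ v →
        ¬? (u Fin.≟ v) ×-dec (H u v Bool.≟ false) ×-dec (suc m ≤? deg H u + deg H v)))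
    -- No pair is left to join, so the degree condition of `Counting` holds: a complete graph yields
    -- the cycle, a sparse one contradicts `dense`.
    ... | no none with Counting.complete-or-sparse H-sym
          (λ i j i≢j Hij → ≮⇒≥ λ m< → none (i , j , i≢j , Hij , m<)) 5m≤4n
    ...   | inj₁ complete = complete-hamiltonian complete 2+m≤n
    ...   | inj₂ sparse   = ⊥-elim (<⇒≱ dense sparse)
    go zero {H} H-sym H-irr fuel≥ dense | yes (u , v , u≢v , Huv , m<) =
      ⊥-elim (<⇒≱ (degSum-addEdge H u v Huv)
        (≤-trans (degSum≤n² (addEdge H u v)) (≤-trans fuel≥ (≤-reflexive (+-identityʳ (degSum H))))))
    go (suc fuel) {H} H-sym H-irr fuel≥ dense | yes (u , v , u≢v , Huv , m<) =
      -- The cycle found after joining `u` and `v` is pulled back to `H`; density survives the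
      -- insertion because the degree sum only grows.
      closure H-sym H-irr 3≤n Huv m<
        (go fuel (addEdge-sym H-sym u v) (addEdge-irrefl {H = H} H-irr u≢v)
          (≤-trans fuel≥ (≤-trans (≤-reflexive (+-suc (degSum H) fuel))
            (+-monoˡ-≤ fuel (degSum-addEdge H u v Huv))))
          (<-≤-trans dense (+-monoˡ-≤ (m * m) (*-monoʳ-≤ 4 (<⇒≤ (degSum-addEdge H u v Huv))))))

-- From lists to permutations

tabulate-cast : ∀ (l : List A) {n} (eq : n ≡ length l) → l ≡ tabulate (lookup l ∘ cast eq)
tabulate-cast l refl = sym (trans (tabulate-cong (λ i → cong (lookup l) (Fin.cast-is-id refl i))) (tabulate-lookup l))

module _ {l : List (Fin n)} (perm : l ↭ allFin n) where

  -- `onIndices` matches positions of `l` with positions of `allFin n`. As `allFin n` holds each `i`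
  -- at position `i`, the composite sends `k` to the entry of `l` at position `k`.
  toHamCycle : HamCycle n
  toHamCycle = Perm.cast-id (sym (↭-length perm)) Perm.∘ₚ onIndices (↭⇒↭ₛ perm) Perm.∘ₚ
    Perm.cast-id (length-tabulate {n = n} id)

  lookup-toHamCycle : ∀ k → lookup l (cast (sym (↭-length perm)) k) ≡ toHamCycle Perm.⟨$⟩ʳ k
  lookup-toHamCycle k = begin
    lookup l k′                                     ≡⟨ ↭ₛ.onIndices-lookup (setoid (Fin n)) (↭⇒↭ₛ perm) k′ ⟩
    lookup (allFin n) j                             ≡⟨ cong (lookup (allFin n)) (Fin.cast-involutive (sym len) len j) ⟨
    lookup (allFin n) (cast (sym len) (cast len j)) ≡⟨ lookup-tabulate id (cast len j) ⟩
    cast len j                                      ∎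
    where
      open ≡-Reasoning
      len = length-tabulate {n = n} id
      k′ = cast (sym (↭-length perm)) k
      j = onIndices (↭⇒↭ₛ perm) Perm.⟨$⟩ʳ k′

  tabulate-toHamCycle : l ≡ tabulate (toHamCycle Perm.⟨$⟩ʳ_)
  tabulate-toHamCycle = trans (tabulate-cast l (sym (↭-length perm))) (tabulate-cong lookup-toHamCycle)

-- The successor along a cyclic order, recursive like `walk`; with `z` equal to `s zero` it is
-- `s ∘ cyc`.
next : ∀ {m} → (Fin (suc m) → A) → A → Fin (suc m) → A
next {m = zero}  s z zero    = z
next {m = suc m} s z zero    = s (suc zero)
next {m = suc m} s z (suc k) = next (s ∘ suc) z k

next-< : ∀ {m} (s : Fin (suc m) → A) z k (k< : suc (toℕ k) < suc m) → next s z k ≡ s (fromℕ< k<)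
next-< {m = zero}  s z zero    k< with s<s⁻¹ k<
... | ()
next-< {m = suc m} s z zero    k< = refl
next-< {m = suc m} s z (suc k) k< = next-< (s ∘ suc) z k (s<s⁻¹ k<)

next-≮ : ∀ {m} (s : Fin (suc m) → A) z k → ¬ suc (toℕ k) < suc m → next s z k ≡ z
next-≮ {m = zero}  s z zero    k≮ = refl
next-≮ {m = suc m} s z zero    k≮ = ⊥-elim (k≮ (s≤s (s≤s z≤n)))
next-≮ {m = suc m} s z (suc k) k≮ = next-≮ (s ∘ suc) z k (k≮ ∘ s≤s)

next-cyc : ∀ {m} (s : Fin (suc m) → A) k → next s (s zero) k ≡ s (cyc k)
next-cyc {m = m} s k with suc (toℕ k) <? suc m
... | yes k< = next-< s (s zero) k k<
... | no k≮  = next-≮ s (s zero) k k≮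

walk-tabulate : ∀ (H : Labeling n) {m} (s : Fin (suc m) → Fin n) z →
  walk H (s zero) (tabulate (s ∘ suc) ∷ʳ z) ≡ ∑ (allFin (suc m)) (λ k → ⟦ H (s k) (next s z k) ⟧)
walk-tabulate H {zero}  s z = refl
walk-tabulate H {suc m} s z = trans
  (cong (⟦ H (s zero) (s (suc zero)) ⟧ +_) (walk-tabulate H (s ∘ suc) z))
  (sym (∑-allFin-suc {suc m} (λ k → ⟦ H (s k) (next s z k) ⟧)))

cycleValue-tabulate : ∀ (H : Labeling n) {m} (s : Fin m → Fin n) →
  cycleValue H (tabulate s) ≡ ∑ (allFin m) (λ k → ⟦ H (s k) (s (cyc k)) ⟧)
cycleValue-tabulate H {zero}  s = refl
cycleValue-tabulate H {suc m} s = trans (walk-tabulate H s (s zero))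
  (∑-cong (allFin (suc m)) (λ k → cong (λ v → ⟦ H (s k) v ⟧) (next-cyc s k)))

cycleValue-plusEdgesC : ∀ (H : Labeling n) {l} (perm : l ↭ allFin n) →
  cycleValue H l ≡ plusEdgesC H (toHamCycle perm)
cycleValue-plusEdgesC {n} H perm = trans (cong (cycleValue H) (tabulate-toHamCycle perm))
  (cycleValue-tabulate H (toHamCycle perm Perm.⟨$⟩ʳ_))

offDiagonal-≤ : ∀ (c : Labeling n) i j → ⟦ offDiagonal c i j ⟧ ≤ ⟦ c i j ⟧
offDiagonal-≤ c i j with does (i Fin.≟ j)
... | true  = z≤n
... | false = ≤-refl

-- Integer square roots and the choice of the threshold.

sqrt : ∀ N → ∃[ r ] r * r ≤ N × N < suc r * suc r
sqrt zero    = 0 , z≤n , s≤s z≤n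
sqrt (suc N) with sqrt N
... | r , r²≤N , N<r with suc N <? suc r * suc r
...   | yes lt = r , m≤n⇒m≤1+n r²≤N , lt
...   | no ≮   = suc r , ≮⇒≥ ≮ , (begin-strict
  suc N                     ≤⟨ N<r ⟩
  suc r * suc r             <⟨ m<m+n _ {suc (suc (r + suc r))} (s≤s z≤n) ⟩
  suc r * suc r + suc (suc (r + suc r)) ≡⟨ lemma r ⟩
  suc (suc r) * suc (suc r) ∎)
  where
    open ≤-Reasoning
    lemma : ∀ r → suc r * suc r + suc (suc (r + suc r)) ≡ suc (suc r) * suc (suc r)
    lemma = solve-∀

square-cancel-≤ : ∀ {a b} → a * a ≤ b * b → a ≤ b
square-cancel-≤ a²≤b² = ≮⇒≥ λ b<a → <⇒≱ (*-mono-< b<a b<a) a²≤b²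

-- Here R = r + 1 exceeds √2 n and m = 2n - R - 7; the number of plus-edges sought is m + 1.
module _ {n r m : ℕ} (2n²< : n * n + n * n < suc r * suc r) (2n≡ : m + suc (r + 7) ≡ n + n) where

  private
    R : ℕ
    R = suc r

    2n≡′ : m + 7 + R ≡ n + n
    2n≡′ = trans (lemma m r) 2n≡
      where
        lemma : ∀ m r → m + 7 + suc r ≡ m + suc (r + 7)
        lemma = solve-∀

    n≤R : n ≤ R
    n≤R = square-cancel-≤ (≤-trans (m≤m+n (n * n) (n * n)) (<⇒≤ 2n²<))

  m+7≤n : m + 7 ≤ n
  m+7≤n = +-cancelʳ-≤ n _ _ (≤-trans (+-monoʳ-≤ (m + 7) n≤R) (≤-reflexive 2n≡′))

  -- 36 n² ≤ 25 · 2 n² gives 6 n ≤ 5 (r + 1).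
  5m≤4n : 5 * m ≤ 4 * n
  5m≤4n = +-cancelʳ-≤ (6 * n) _ _ (begin
    5 * m + 6 * n           ≤⟨ +-mono-≤ (*-monoʳ-≤ 5 (m≤m+n m 7)) (square-cancel-≤ 36n²≤) ⟩
    5 * (m + 7) + 5 * R     ≡⟨ *-distribˡ-+ 5 (m + 7) R ⟨
    5 * (m + 7 + R)         ≡⟨ cong (5 *_) 2n≡′ ⟩
    5 * (n + n)             ≡⟨ lemma₂ n ⟩
    4 * n + 6 * n           ∎)
    where
      open ≤-Reasoning
      lemma₁ : ∀ n → 6 * n * (6 * n) + 14 * (n * n) ≡ 25 * (n * n + n * n)
      lemma₁ = solve-∀
      lemma₂ : ∀ n → 5 * (n + n) ≡ 4 * n + 6 * n
      lemma₂ = solve-∀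
      lemma₃ : ∀ R → 25 * (R * R) ≡ 5 * R * (5 * R)
      lemma₃ = solve-∀
      36n²≤ : 6 * n * (6 * n) ≤ 5 * R * (5 * R)
      36n²≤ = begin
        6 * n * (6 * n)                ≤⟨ m≤m+n _ (14 * (n * n)) ⟩
        6 * n * (6 * n) + 14 * (n * n) ≡⟨ lemma₁ n ⟩
        25 * (n * n + n * n)           ≤⟨ *-monoʳ-≤ 25 (<⇒≤ 2n²<) ⟩
        25 * (R * R)                   ≡⟨ lemma₃ R ⟩
        5 * R * (5 * R)                ∎

  -- As 4D = 2n² - 2n, the claim is 4nm + 14n < 2n² + m². From (2n - m)² = (R + 7)² one gets 2n² +
  -- m² - 4nm = (R + 7)² - 2n² > 14R + 49, and R ≥ n. The 7 in the choice of `m` thus supplies 14 =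
  -- 12 + 2.
  balanced-dense : ∀ {D} → D + D + n ≡ n * n → 4 * (n * m) + 12 * n < 4 * D + m * m
  -- The terms added to both sides clear all subtractions.
  balanced-dense {D} 2D≡ = +-cancelʳ-< (2 * n + 2 * (n * n) + R * R) _ _ (begin-strict
    4 * (n * m) + 12 * n + (2 * n + 2 * (n * n) + R * R)
      ≡⟨ lemma₁ n m R ⟩
    (n * n + n * n) + (4 * (n * m) + 14 * n + R * R)
      <⟨ +-mono-<-≤ 2n²< (+-monoˡ-≤ (R * R) (+-monoʳ-≤ (4 * (n * m)) (*-monoʳ-≤ 14 n≤R))) ⟩
    R * R + (4 * (n * m) + 14 * R + R * R)
      ≤⟨ m≤m+n _ 49 ⟩
    R * R + (4 * (n * m) + 14 * R + R * R) + 49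
      ≡⟨ lemma₂ R (n * m) ⟩
    (7 + R) * (7 + R) + 4 * (n * m) + R * R
      ≡⟨ cong (_+ R * R) square ⟩
    4 * (n * n) + m * m + R * R
      ≡⟨ lemma₃ n m R ⟩
    2 * (n * n) + (m * m + 2 * (n * n) + R * R)
      ≡⟨ cong (λ x → 2 * x + (m * m + 2 * (n * n) + R * R)) 2D≡ ⟨
    2 * (D + D + n) + (m * m + 2 * (n * n) + R * R)
      ≡⟨ lemma₄ n m R D ⟩
    4 * D + m * m + (2 * n + 2 * (n * n) + R * R) ∎)
    where
      open ≤-Reasoning
      lemma₁ : ∀ n m R → 4 * (n * m) + 12 * n + (2 * n + 2 * (n * n) + R * R)
        ≡ (n * n + n * n) + (4 * (n * m) + 14 * n + R * R)
      lemma₁ = solve-∀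
      lemma₂ : ∀ R x → R * R + (4 * x + 14 * R + R * R) + 49 ≡ (7 + R) * (7 + R) + 4 * x + R * R
      lemma₂ = solve-∀
      lemma₃ : ∀ n m R → 4 * (n * n) + m * m + R * R ≡ 2 * (n * n) + (m * m + 2 * (n * n) + R * R)
      lemma₃ = solve-∀
      lemma₄ : ∀ n m R D → 2 * (D + D + n) + (m * m + 2 * (n * n) + R * R)
        ≡ 4 * D + m * m + (2 * n + 2 * (n * n) + R * R)
      lemma₄ = solve-∀
      lemma₅ : ∀ s n m → s * s + 4 * (n * m) ≡ s * s + 2 * m * (n + n)
      lemma₅ = solve-∀
      lemma₆ : ∀ R m → (7 + R) * (7 + R) + 2 * m * (m + 7 + R) ≡ (m + 7 + R) * (m + 7 + R) + m * m
      lemma₆ = solve-∀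
      lemma₇ : ∀ n m → (n + n) * (n + n) + m * m ≡ 4 * (n * n) + m * m
      lemma₇ = solve-∀
      square : (7 + R) * (7 + R) + 4 * (n * m) ≡ 4 * (n * n) + m * m
      square = trans (lemma₅ (7 + R) n m) (trans
        (subst (λ x → (7 + R) * (7 + R) + 2 * m * x ≡ x * x + m * m) 2n≡′ (lemma₆ R m))
        (lemma₇ n m))

balanced-hamiltonian : ∀ {c : Labeling n} r → 4 ≤ n → Symmetric c → Balanced c →
  n * n + n * n < suc r * suc r → ∃[ C ] n + n ≤ plusEdgesC c C + (r + 7)
balanced-hamiltonian {n} {c} r 4≤n c-sym bal 2n²< with suc (r + 7) ≤? n + n
-- Here 2n ≤ r + 7, so the bound is trivial and any cycle will do.
... | no ≰ = Perm.id , ≤-trans (≮⇒≥ ≰) (m≤n+m (r + 7) (plusEdgesC c Perm.id))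
... | yes le = toHamCycle perm , (begin
  n + n                                                   ≡⟨ 2n≡ ⟨
  m + suc (r + 7)                                         ≡⟨ +-suc m (r + 7) ⟩
  suc m + (r + 7)                                         ≤⟨ +-monoˡ-≤ (r + 7) m< ⟩
  cycleValue (offDiagonal c) l + (r + 7)                  ≡⟨ cong (_+ (r + 7)) (cycleValue-plusEdgesC (offDiagonal c) perm) ⟩
  plusEdgesC (offDiagonal c) (toHamCycle perm) + (r + 7)  ≤⟨ +-monoˡ-≤ (r + 7) (∑-mono (allFin n) (λ k → offDiagonal-≤ c _ _)) ⟩
  plusEdgesC c (toHamCycle perm) + (r + 7)                ∎)
  where
    open ≤-Reasoning
    m : ℕ
    -- Chosen so that `suc m` is the target 2n - r - 7; the case hypothesis `le` makes the
    -- subtraction exact.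
    m = n + n ∸ suc (r + 7)
    2n≡ : m + suc (r + 7) ≡ n + n
    2n≡ = m∸n+n≡m le
    2+m≤n : 2 + m ≤ n
    2+m≤n = ≤-trans (≤-reflexive (+-comm 2 m)) (≤-trans (+-monoʳ-≤ m (m≤m+n 2 5)) (m+7≤n {n} 2n²< 2n≡))
    cycle : HamiltonianList (offDiagonal c) (suc m)
    cycle = dense-hamiltonian (offDiagonal-sym c-sym) (offDiagonal-irrefl c) (<⇒≤ 4≤n)
      (5m≤4n {n} 2n²< 2n≡) 2+m≤n
      (balanced-dense {n} 2n²< 2n≡ {degSum (offDiagonal c)} (balanced-degSum c-sym bal))
    l : List (Fin n)
    l = proj₁ cycle
    perm : l ↭ allFin n
    perm = proj₁ (proj₂ cycle)
    m< : suc m ≤ cycleValue (offDiagonal c) l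
    m< = proj₂ (proj₂ cycle)

-- Rational estimates

toℚᵘ-ℕtoℚ : ∀ n → ℚ.toℚᵘ (ℕtoℚ n) ℚᵘ.≃ ℚᵘ.mkℚᵘ (pos n) 0
toℚᵘ-ℕtoℚ n = ℚ.toℚᵘ-fromℚᵘ (ℚᵘ.mkℚᵘ (pos n) 0)

ℕtoℚ-+ : ∀ a b → ℕtoℚ (a + b) ≡ ℕtoℚ a ℚ.+ ℕtoℚ b
ℕtoℚ-+ a b = ℚ.toℚᵘ-injective (begin-equality
  ℚ.toℚᵘ (ℕtoℚ (a + b))                    ≃⟨ toℚᵘ-ℕtoℚ (a + b) ⟩
  ℚᵘ.mkℚᵘ (pos (a + b)) 0                    ≃⟨ ℚᵘ.*≡* (trans (cong (ℤ._* pos 1) (ℤ.pos-+ a b)) (lemma (pos a) (pos b))) ⟩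
  ℚᵘ.mkℚᵘ (pos a) 0 ℚᵘ.+ ℚᵘ.mkℚᵘ (pos b) 0     ≃⟨ ℚᵘ.+-cong (toℚᵘ-ℕtoℚ a) (toℚᵘ-ℕtoℚ b) ⟨
  ℚ.toℚᵘ (ℕtoℚ a) ℚᵘ.+ ℚ.toℚᵘ (ℕtoℚ b)     ≃⟨ ℚ.toℚᵘ-homo-+ (ℕtoℚ a) (ℕtoℚ b) ⟨
  ℚ.toℚᵘ (ℕtoℚ a ℚ.+ ℕtoℚ b)               ∎)
  where
    open ℚᵘ.≤-Reasoning
    lemma : ∀ x y → (x ℤ.+ y) ℤ.* pos 1 ≡ (x ℤ.* pos 1 ℤ.+ y ℤ.* pos 1) ℤ.* pos 1
    lemma = ℤ-solve-∀

ℕtoℚ-* : ∀ a b → ℕtoℚ (a * b) ≡ ℕtoℚ a ℚ.* ℕtoℚ b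
ℕtoℚ-* a b = ℚ.toℚᵘ-injective (begin-equality
  ℚ.toℚᵘ (ℕtoℚ (a * b))                    ≃⟨ toℚᵘ-ℕtoℚ (a * b) ⟩
  ℚᵘ.mkℚᵘ (pos (a * b)) 0                    ≃⟨ ℚᵘ.*≡* (cong (ℤ._* pos 1) (ℤ.pos-* a b)) ⟩
  ℚᵘ.mkℚᵘ (pos a) 0 ℚᵘ.* ℚᵘ.mkℚᵘ (pos b) 0     ≃⟨ ℚᵘ.*-cong (toℚᵘ-ℕtoℚ a) (toℚᵘ-ℕtoℚ b) ⟨
  ℚ.toℚᵘ (ℕtoℚ a) ℚᵘ.* ℚ.toℚᵘ (ℕtoℚ b)     ≃⟨ ℚ.toℚᵘ-homo-* (ℕtoℚ a) (ℕtoℚ b) ⟨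
  ℚ.toℚᵘ (ℕtoℚ a ℚ.* ℕtoℚ b)               ∎)
  where open ℚᵘ.≤-Reasoning

ℕtoℚ-mono-≤ : ∀ {a b} → a ≤ b → ℕtoℚ a ℚ.≤ ℕtoℚ b
ℕtoℚ-mono-≤ {a} {b} a≤b = ℚ.toℚᵘ-cancel-≤ (begin
  ℚ.toℚᵘ (ℕtoℚ a)  ≃⟨ toℚᵘ-ℕtoℚ a ⟩
  ℚᵘ.mkℚᵘ (pos a) 0  ≤⟨ ℚᵘ.*≤* (ℤ.*-monoʳ-≤-nonNeg (pos 1) (ℤ.+≤+ a≤b)) ⟩
  ℚᵘ.mkℚᵘ (pos b) 0  ≃⟨ toℚᵘ-ℕtoℚ b ⟨
  ℚ.toℚᵘ (ℕtoℚ b)  ∎)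
  where open ℚᵘ.≤-Reasoning

constant-is-o : ∀ a ε → 0ℚ ℚ.< ε → ∃[ N ] (∀ n → N ≤ n → ∣ ℕtoℚ a ∣ ℚ.≤ ε ℚ.* ℕtoℚ n)
constant-is-o a (mkℚ (pos zero)     d _) (ℚ.*<* (ℤ.+<+ ()))
constant-is-o a (mkℚ (ℤ.-[1+ _ ]) d _) (ℚ.*<* ())
-- Here ε = (e + 1)/(d + 1) ≥ 1/(d + 1), so εn ≥ a as soon as n ≥ a(d + 1).
constant-is-o a ε@(mkℚ +[1+ e ]   d _) _ = a * suc d , bound
  where
    open ℚᵘ.≤-Reasoning
    bound : ∀ n → a * suc d ≤ n → ∣ ℕtoℚ a ∣ ℚ.≤ ε ℚ.* ℕtoℚ n
    bound n ad≤n = subst (ℚ._≤ ε ℚ.* ℕtoℚ n) (sym (ℚ.0≤p⇒∣p∣≡p (ℕtoℚ-mono-≤ {0} {a} z≤n)))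
      (ℚ.toℚᵘ-cancel-≤ (begin
        ℚ.toℚᵘ (ℕtoℚ a)                    ≃⟨ toℚᵘ-ℕtoℚ a ⟩
        ℚᵘ.mkℚᵘ (pos a) 0                    ≤⟨ ℚᵘ.*≤* cross ⟩
        ℚ.toℚᵘ ε ℚᵘ.* ℚᵘ.mkℚᵘ (pos n) 0      ≃⟨ ℚᵘ.*-congˡ {ℚ.toℚᵘ ε} (toℚᵘ-ℕtoℚ n) ⟨
        ℚ.toℚᵘ ε ℚᵘ.* ℚ.toℚᵘ (ℕtoℚ n)      ≃⟨ ℚ.toℚᵘ-homo-* ε (ℕtoℚ n) ⟨
        ℚ.toℚᵘ (ε ℚ.* ℕtoℚ n)              ∎))
      where
        cross : pos a ℤ.* pos (suc d * 1) ℤ.≤ (+[1+ e ] ℤ.* pos n) ℤ.* pos 1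
        cross = subst₂ ℤ._≤_
          (trans (cong (λ x → pos (a * x)) (sym (*-identityʳ (suc d)))) (ℤ.pos-* a _))
          (trans (ℤ.pos-* (suc e) n) (sym (ℤ.*-identityʳ _)))
          (ℤ.+≤+ (≤-trans ad≤n (m≤m+n n (e * n))))

-- Either 2n - x - b is at most zero, or it is a natural number `d` with d ≤ r, and then d² ≤ r² ≤
-- 2n².
geTwoMinusSqrt2Times : ∀ n x b r → r * r ≤ n * n + n * n → n + n ≤ x + (r + b) →
  GeTwoMinusSqrt2Times (ℕtoℚ x ℚ.+ ℕtoℚ b) n
geTwoMinusSqrt2Times n x b r r²≤ 2n≤ with ≤-total (n + n) (x + b)
... | inj₁ 2n≤x+b = inj₁ (begin
  2ℚ ℚ.* ℕtoℚ n ℚ.- y             ≡⟨ cong (ℚ._- y) (trans (sym (ℕtoℚ-* 2 n)) (cong ℕtoℚ (2* n))) ⟩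
  ℕtoℚ (n + n) ℚ.- y              ≤⟨ ℚ.+-monoˡ-≤ (ℚ.- y) (ℕtoℚ-mono-≤ 2n≤x+b) ⟩
  ℕtoℚ (x + b) ℚ.- y              ≡⟨ cong (ℚ._- y) (ℕtoℚ-+ x b) ⟩
  y ℚ.- y                         ≡⟨ ℚ.+-inverseʳ y ⟩
  0ℚ                              ∎)
  where
    open ℚ.≤-Reasoning
    2ℚ = ℕtoℚ 2
    y = ℕtoℚ x ℚ.+ ℕtoℚ b
    2* : ∀ n → 2 * n ≡ n + n
    2* = solve-∀
... | inj₂ x+b≤2n with m≤n⇒∃[o]m+o≡n x+b≤2n
...   | d , x+b+d≡ = inj₂ (begin
  (2ℚ ℚ.* ℕtoℚ n ℚ.- y) ℚ.* (2ℚ ℚ.* ℕtoℚ n ℚ.- y) ≡⟨ cong (λ t → t ℚ.* t) difference ⟩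
  ℕtoℚ d ℚ.* ℕtoℚ d               ≡⟨ ℕtoℚ-* d d ⟨
  ℕtoℚ (d * d)                    ≤⟨ ℕtoℚ-mono-≤ (≤-trans (*-mono-≤ d≤r d≤r) r²≤) ⟩
  ℕtoℚ (n * n + n * n)            ≡⟨ cong ℕtoℚ (2* (n * n)) ⟨
  ℕtoℚ (2 * (n * n))              ≡⟨ ℕtoℚ-* 2 (n * n) ⟩
  2ℚ ℚ.* ℕtoℚ (n * n)             ≡⟨ cong (2ℚ ℚ.*_) (ℕtoℚ-* n n) ⟩
  2ℚ ℚ.* (ℕtoℚ n ℚ.* ℕtoℚ n)      ∎)
  where
    open ℚ.≤-Reasoning
    2ℚ = ℕtoℚ 2
    y = ℕtoℚ x ℚ.+ ℕtoℚ b
    2* : ∀ n → 2 * n ≡ n + n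
    2* = solve-∀
    lemma : ∀ x r b → x + (r + b) ≡ x + b + r
    lemma = solve-∀
    d≤r : d ≤ r
    d≤r = +-cancelˡ-≤ (x + b) _ _ (subst₂ _≤_ (sym x+b+d≡) (lemma x r b) 2n≤)
    difference : 2ℚ ℚ.* ℕtoℚ n ℚ.- y ≡ ℕtoℚ d
    difference = begin-equality
      2ℚ ℚ.* ℕtoℚ n ℚ.- y          ≡⟨ cong (ℚ._- y) (trans (sym (ℕtoℚ-* 2 n)) (cong ℕtoℚ (trans (2* n) (sym x+b+d≡)))) ⟩
      ℕtoℚ (x + b + d) ℚ.- y       ≡⟨ cong (ℚ._- y) (trans (ℕtoℚ-+ (x + b) d) (cong (ℚ._+ ℕtoℚ d) (ℕtoℚ-+ x b))) ⟩
      y ℚ.+ ℕtoℚ d ℚ.- y           ≡⟨ cong (ℚ._- y) (ℚ.+-comm y (ℕtoℚ d)) ⟩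
      ℕtoℚ d ℚ.+ y ℚ.- y           ≡⟨ ℚ.+-assoc (ℕtoℚ d) y (ℚ.- y) ⟩
      ℕtoℚ d ℚ.+ (y ℚ.- y)         ≡⟨ cong (ℕtoℚ d ℚ.+_) (ℚ.+-inverseʳ y) ⟩
      ℕtoℚ d ℚ.+ 0ℚ                ≡⟨ ℚ.+-identityʳ (ℕtoℚ d) ⟩
      ℕtoℚ d                       ∎

theorem2 : Σ (ℕ → ℚ) λ g →
    ((ε : ℚ) → 0ℚ ℚ.< ε → ∃ λ N → (n : ℕ) → N ≤ n →
    ∣ g n ∣ ℚ.≤ ε ℚ.* ℕtoℚ n)
    ×
    ((n : ℕ) → 4 ≤ n → (c : Labeling n) → Symmetric c → Balanced c →
    ∃ λ (C : HamCycle n) →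
    GeTwoMinusSqrt2Times (ℕtoℚ (plusEdgesC c C) ℚ.+ g n) n)
-- With r = ⌊√2 n⌋ the cycle has at least 2n - r - 7 plus-edges, so the error term can be the
-- constant 7.
theorem2 = (λ _ → ℕtoℚ 7) , constant-is-o 7 , λ n 4≤n c c-sym bal →
  let r , r²≤2n² , 2n²< = sqrt (n * n + n * n)
      C , 2n≤ = balanced-hamiltonian r 4≤n c-sym bal 2n²<
  in C , geTwoMinusSqrt2Times n (plusEdgesC c C) 7 r r²≤2n² 2n≤
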